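{- Let $f\in\mathbb{B}_n$. Then the procedure ANFto2XNF (described in the context), applied to $f$, terminates after finitely many steps and returns a 2-XNF representation of $f$.
   Context: $\mathbb{B}_n=\mathbb{F}_2[X_1,\dots,X_n]/\langle X_1^2-X_1,\dots,X_n^2-X_n\rangle$ is the ring of Boolean polynomials, with indeterminates $x_i$ the residue classes of $X_i$. $\mathbb{B}_{n,m}$ is the Boolean polynomial ring in $n+m$ indeterminates $x_1,\dots,x_n,y_1,\dots,y_m$. Every Boolean polynomial is uniquely a sum of distinct square-free terms (products of distinct indeterminates); the set of these terms is its support $\mathrm{Supp}(f)$, and the degree is the maximal degree of a term in the support. A Boolean polynomial is called linear if it lies in the $\mathbb{F}_2$-span of $1$ and the indeterminates. For a subset $S$ of a Boolean polynomial ring in $N$ indeterminates, $\mathcal{Z}(S)\subseteq\mathbb{F}_2^N$ is the set of common zeros of the elements of $S$. For $S\subseteq\mathbb{F}_2^n$ and $T\subseteq\mathbb{F}_2^{n+m}$ write $S\equiv_n T$ if the projection to the first $n$ coordinates restricts to a bijection $T\to S$. A set $S=\{f_1g_1,\dots,f_kg_k,\ell_1,\dots,\ell_s\}\subseteq\mathbb{B}_{n,m}$ (for some $m\ge 0$), with all $f_i,g_i,\ell_j$ linear Boolean polynomials of $\mathbb{B}_{n,m}$, is called a 2-XNF representation of an ideal $I\subseteq\mathbb{B}_n$ if $\mathcal{Z}(I)\equiv_n\mathcal{Z}(S)$. A 2-XNF representation of $f\in\mathbb{B}_n$ is a 2-XNF representation of $\langle f\rangle$. Procedure ANFto2XNF.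 Input $f\in\mathbb{B}_n$. Start with $i=0$, $M=\emptyset$. For each term $t$ in the support of the input polynomial: while $\deg(t)>1$, increase $i$ by $1$ and let $y_i$ be a new indeterminate; write $f=t+f'$ (with $f'=f-t\in\mathbb{B}_{n,i-1}$) and $t=\ell_1\ell_2 s$ where $s$ is a term and $\ell_1,\ell_2$ are distinct indeterminates (dividing $t$, with $s$ the product of the remaining indeterminates of $t$); replace $t$ by $y_is$ and $f$ by $y_is+f'$; adjoin $y_i(\ell_2+1)$ and $\ell_2(\ell_1+y_i)$ to $M$. Finally return $M\cup\{f\}$. -}

module Defs where

open import Level using (0ℓ; _⊔_)
open import Algebra.Bundles using (RawRing; CommutativeRing)
import Algebra.Definitions.RawMonoid as RawMonoidDefinitions
import Algebra.Definitions.RawSemiring as RawSemiringDefinitions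
open import Data.Bool.Base using (Bool; true; false; if_then_else_; _∧_; _xor_)
open import Data.Bool.Properties using (xor-∧-commutativeRing)
open import Data.Fin.Base using (Fin; fromℕ; _↑ʳ_)
open import Data.Fin.Subset as Subset using (Subset; inside; outside; ∣_∣)
open import Data.List.Base as List using (List; []; _∷_)
import Data.List.Membership.Propositional as List∈
open import Data.List.Relation.Unary.All using (All)
open import Data.List.Relation.Unary.Unique.Propositional using (Unique)
open import Data.Nat.Base as ℕ using (ℕ; suc)
import Data.Nat.Properties as ℕ
open import Data.Product.Base using (_×_; _,_; ∃; ∃-syntax; proj₁)
open import Data.Sum.Base using (_⊎_)
open import Data.Vec.Base as Vec using (Vec; _++_; _∷ʳ_; take; drop; replicate)
open import Data.Vec.Properties using (≡-dec)
open import Function.Base using (_on_; flip)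
open import Function.Definitions using (Bijective)
open import Induction.WellFounded using (Acc)
open import Relation.Binary.Construct.Closure.ReflexiveTransitive using (Star)
open import Relation.Binary.PropositionalEquality using (_≡_; _≢_)
open import Relation.Nullary using (does)
open import Relation.Unary using (Pred; _∈_; ｛_｝)

module _ {c ℓ} (R : RawRing c ℓ) where
  open RawRing R

  data Ideal {p} (S : Pred Carrier p) : Pred Carrier (c ⊔ ℓ ⊔ p) where
    gen  : ∀ {a} → a ∈ S → a ∈ Ideal S
    0∈   : 0# ∈ Ideal S
    +∈   : ∀ {a b} → a ∈ Ideal S → b ∈ Ideal S → a + b ∈ Ideal S
    *∈   : ∀ r {a} → a ∈ Ideal S → r * a ∈ Ideal S
    resp : ∀ {a b} → a ≈ b → a ∈ Ideal S → b ∈ Ideal S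

  -- R / ⟨S⟩: same carrier and operations, equality is congruence modulo ⟨S⟩.
  Quotient : ∀ {p} → Pred Carrier p → RawRing c (c ⊔ ℓ ⊔ p)
  Quotient S = record
    { Carrier = Carrier
    ; _≈_     = λ a b → a + - b ∈ Ideal S
    ; _+_     = _+_
    ; _*_     = _*_
    ; -_      = -_
    ; 0#      = 0#
    ; 1#      = 1#
    }

𝔽₂ : RawRing 0ℓ 0ℓ
𝔽₂ = CommutativeRing.rawRing xor-∧-commutativeRing

-- exponent vectors
Monomial : ℕ → Set
Monomial N = Vec ℕ N

-- A list stands for the sum of its entries; repetitions are allowed and
-- only the multiplicity modulo 2 of a monomial matters.  Hence negation
-- is the identity.
Poly : ℕ → Set
Poly N = List (Monomial N)

coeff : ∀ {N} → Poly N → Monomial N → Bool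
coeff f m = List.foldr _xor_ false (List.map (λ m′ → does (≡-dec ℕ._≟_ m′ m)) f)

𝔽₂[X] : ℕ → RawRing 0ℓ 0ℓ
𝔽₂[X] N = record
  { Carrier = Poly N
  ; _≈_     = λ f g → ∀ m → coeff f m ≡ coeff g m
  ; _+_     = List._++_
  ; _*_     = List.cartesianProductWith (Vec.zipWith ℕ._+_)
  ; -_      = λ f → f
  ; 0#      = []
  ; 1#      = replicate N 0 ∷ []
  }

-- a square-free term, given by the set of indeterminates dividing it
Term : ℕ → Set
Term N = Subset N

deg : ∀ {N} → Term N → ℕ
deg t = ∣ t ∣

term : ∀ {N} → Term N → Poly N
term t = Vec.map (λ b → if b then 1 else 0) t ∷ []

X : ∀ {N} → Fin N → Poly N
X i = term Subset.⁅ i ⁆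

fieldEquation : ∀ {N} → Fin N → Poly N
fieldEquation {N} i = X i * X i + - X i
  where open RawRing (𝔽₂[X] N)

𝔹 : ℕ → RawRing 0ℓ 0ℓ
𝔹 N = Quotient (𝔽₂[X] N) (λ f → ∃[ i ] f ≡ fieldEquation i)

BoolPoly : ℕ → Set
BoolPoly N = RawRing.Carrier (𝔹 N)

module _ {N : ℕ} where
  open RawRing (𝔹 N) public using (_≈_; _+_; _*_; -_; 0#; 1#)
  open RawMonoidDefinitions (RawRing.+-rawMonoid (𝔹 N)) public using (sum)

-- An enumeration, without repetitions, of the support of f.
IsSupport : ∀ {N} → BoolPoly N → List (Term N) → Set
IsSupport f L = Unique L × f ≈ List.foldr _+_ 0# (List.map term L)

_·_ : ∀ {N} → Bool → BoolPoly N → BoolPoly N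
c · f = if c then f else 0#

Linear : ∀ {N} → Pred (BoolPoly N) 0ℓ
Linear {N} f =
  ∃[ c ] ∃ λ (a : Fin N → Bool) → f ≈ (c · 1#) + sum (λ i → a i · X i)

Point : ℕ → Set
Point N = Vec Bool N

open RawSemiringDefinitions (RawRing.rawSemiring 𝔽₂)
  using (_^_)

evalMonomial : ∀ {N} → Point N → Monomial N → Bool
evalMonomial p m = Vec.foldr′ _∧_ true (Vec.zipWith _^_ p m)

eval : ∀ {N} → Point N → BoolPoly N → Bool
eval p f = List.foldr _xor_ false (List.map (evalMonomial p) f)

𝒵 : ∀ {N} → Pred (BoolPoly N) 0ℓ → Pred (Point N) 0ℓ
𝒵 S p = ∀ {f} → f ∈ S → eval p f ≡ false

-- S ≡ₙ T: two elements of a subset count as equal when the points are.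
_≡ₙ_ : ∀ {n m} → Pred (Point n) 0ℓ → Pred (Point (n ℕ.+ m)) 0ℓ → Set
_≡ₙ_ {n} S T =
  ∃ λ (into : ∀ p → p ∈ T → take n p ∈ S) →
    Bijective {A = ∃ T} {B = ∃ S} (_≡_ on proj₁) (_≡_ on proj₁)
      (λ (p , p∈T) → take n p , into p p∈T)

-- 𝔹ₙ,ₘ: the first n indeterminates are the xᵢ, the last m are the yⱼ.
BoolPoly₂ : ℕ → ℕ → Set
BoolPoly₂ n m = BoolPoly (n ℕ.+ m)

-- The finite set S is given by a list.
Is2XNF : ∀ {N} → List (BoolPoly N) → Set
Is2XNF S = All (λ h → (∃[ f ] ∃[ g ] Linear f × Linear g × h ≈ f * g) ⊎ Linear h) S

Is2XNFRepresentation : ∀ {n} → Pred (BoolPoly n) 0ℓ →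
                       (m : ℕ) → List (BoolPoly₂ n m) → Set
Is2XNFRepresentation I m S = Is2XNF S × 𝒵 I ≡ₙ 𝒵 (List∈._∈ S)

⟨_⟩ : ∀ {n} → BoolPoly n → Pred (BoolPoly n) 0ℓ
⟨_⟩ {n} f = Ideal (𝔹 n) ｛ f ｝

-- Insert an entry for the new last indeterminate y_{i+1}.
extend : ∀ {A : Set} {n i} → A → Vec A (n ℕ.+ i) → Vec A (n ℕ.+ suc i)
extend {n = n} a v = take n v ++ (drop n v ∷ʳ a)

-- the inclusions 𝔹ₙ ⊆ 𝔹ₙ,₀ and 𝔹ₙ,ᵢ ⊆ 𝔹ₙ,ᵢ₊₁
ι₀ : ∀ {n} → BoolPoly n → BoolPoly₂ n 0
ι₀ = List.map (_++ Vec.[])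

ι : ∀ {n i} → BoolPoly₂ n i → BoolPoly₂ n (suc i)
ι {n} = List.map (extend {n = n} 0)

data State (n : ℕ) : Set where
  input  : (f : BoolPoly n) → State n
  -- at the head of the for loop; `todo` lists the terms of the support of the
  -- input polynomial that have not been treated yet
  for    : (todo : List (Term n)) (i : ℕ) (M : List (BoolPoly₂ n i))
           (f : BoolPoly₂ n i) → State n
  -- at the head of the while loop, with current term t
  while  : (todo : List (Term n)) (i : ℕ) (M : List (BoolPoly₂ n i))
           (t : Term (n ℕ.+ i)) (f : BoolPoly₂ n i) → State n
  return : (m : ℕ) (S : List (BoolPoly₂ n m)) → State n

-- One step of the procedure.  It is a relation because the order of the
-- terms and the choice of ℓ₁ and ℓ₂ are left open.
module _ {n : ℕ} where

  infix 4 _⟶_ _⟶*_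

  data _⟶_ : State n → State n → Set where

    -- The terms may be enumerated in any order.
    start : ∀ {f L} → IsSupport f L → input f ⟶ for L 0 [] (ι₀ f)

    enter : ∀ {t todo i M f} →
            for (t ∷ todo) i M f ⟶ while todo i M (t ++ Subset.⊥) f

    -- t = ℓ₁ ℓ₂ s, with ℓ₁ and ℓ₂ the indeterminates with indices u and v
    body  : ∀ {todo i M t f u v} → 1 ℕ.< deg t →
            u ≢ v → u Subset.∈ t → v Subset.∈ t →
            let y  = X (n ↑ʳ fromℕ i)
                ℓ₁ = ι (X u)
                ℓ₂ = ι (X v)
                s  = t Subset.- u Subset.- v
                ys = extend {n = n} inside s
                f′ = f + - term t
            in while todo i M t f
               ⟶ while todo (suc i)
                    (y * (ℓ₂ + 1#) ∷ ℓ₂ * (ℓ₁ + y) ∷ List.map ι M)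
                    ys (term ys + ι f′)

    exit  : ∀ {todo i M t f} → deg t ℕ.≤ 1 →
            while todo i M t f ⟶ for todo i M f

    done  : ∀ {i M f} → for [] i M f ⟶ return i (f ∷ M)

  _⟶*_ : State n → State n → Set
  _⟶*_ = Star _⟶_

-- Every run from σ is finite.
Terminates : ∀ {n} → State n → Set
Terminates = Acc (flip _⟶_)

-- No run from σ gets stuck before reaching a `return` state, and every
-- output satisfies P.
Returns : ∀ {n} → State n → (∀ m → List (BoolPoly₂ n m) → Set) → Set
Returns σ P = ∀ {τ} → σ ⟶* τ →
  (∃[ τ′ ] τ ⟶ τ′) ⊎ (∃[ m ] ∃[ S ] τ ≡ return m S × P m S)

{-# OPTIONS --safe #-}

-- Modulo the field equations every monomial reduces to a square-free term,
-- and a sum of distinct terms that vanishes on all of 𝔽₂ⁿ is empty.  So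
-- equality in 𝔹 is equality of Boolean functions, and identities between
-- Boolean polynomials may be checked pointwise.
--
-- The products y (ℓ₂ + 1) and ℓ₂ (ℓ₁ + y) both vanish exactly when y = ℓ₁ ℓ₂.
-- Hence 𝒵(M) remains the graph of a function on 𝔽₂ⁿ, along which the current
-- polynomial agrees with the input.  At the end only terms of degree
-- at most 1 are left in it.  Each iteration lowers deg t.

module Submission where

open import Defs
open import Algebra.Bundles using (RawRing)
import Algebra.Definitions.RawSemiring as RawSemiringDefinitions
open import Data.Bool.Base using (Bool; true; false; if_then_else_; _∧_; _xor_)
open import Data.Bool.Properties
  using (xor-assoc; xor-same; xor-identityʳ; ∧-assoc; ∧-comm; ∧-zeroʳ;
         ∧-identityʳ; ∧-distribˡ-xor; ∧-distribʳ-xor)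
import Data.Bool.Properties as Bool
open import Data.Bool.Solver using (module xor-∧-Solver)
open import Data.Fin.Base using (Fin; zero; suc; fromℕ; _↑ʳ_)
open import Data.Fin.Subset as Subset using (Subset; inside; outside; ∣_∣; ⁅_⁆)
open import Data.Fin.Subset.Properties
  using (∣⁅x⁆∣≡1; p─⊥≡p; x∈p⇒∣p-x∣<∣p∣; x∈p∧x≢y⇒x∈p-y)
open import Data.List.Base as List using (List; []; _∷_)
open import Data.List.Membership.Propositional using (_∉_) renaming (_∈_ to _∈ₗ_)
open import Data.List.Membership.Propositional.Properties using (∈-map⁺; ∈-map⁻)
import Data.List.Properties as List
open import Data.List.Relation.Unary.All as All using (All; []; _∷_)
import Data.List.Relation.Unary.All.Properties as All
open import Data.List.Relation.Unary.AllPairs using ([]; _∷_)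
open import Data.List.Relation.Unary.Any using (here; there)
open import Data.List.Relation.Unary.Unique.Propositional using (Unique)
open import Data.Nat.Base as ℕ using (ℕ; zero; suc; s≤s; z≤n)
open import Data.Nat.Induction using (<-wellFounded)
import Data.Nat.Properties as ℕ
open import Data.Product.Base using (_×_; _,_; ∃; ∃-syntax; proj₁; proj₂)
open import Data.Sum.Base using (_⊎_; inj₁; inj₂)
open import Data.Vec.Base as Vec using (Vec; []; _∷_; _++_; take; drop; lookup)
import Data.Vec.Properties as Vec
open import Function.Base using (_∘_; id)
open import Induction.WellFounded using (Acc; acc)
open import Relation.Binary.Construct.Closure.ReflexiveTransitive as Star
  using (Star; ε; _◅_; _◅◅_)
open import Relation.Binary.Definitions using (DecidableEquality)
open import Relation.Binary.PropositionalEquality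
  using (_≡_; _≢_; refl; sym; trans; cong; cong₂; subst; module ≡-Reasoning)
open import Relation.Nullary using (yes; no; does; contradiction)
open import Relation.Unary using (Pred; _∈_)

open RawSemiringDefinitions (RawRing.rawSemiring 𝔽₂) using (_^_)

-- Linearity and the product form are equalities in the quotient ring, while the procedure works on
-- lists in which cancelled terms stay visible: subtracting `t` only appends it once more. The lists
-- therefore do not show which terms are left, and the invariant speaks about values instead: the
-- current polynomial is a linear one plus an explicit function `ρ` of the unfinished terms. This
-- equation is kept at every point, as linearity requires, whereas agreement with the input can be
-- kept only on 𝒵(M), because replacing ℓ₁ ℓ₂ by y changes the polynomial elsewhere. The reduction
-- to square-free terms has a second purpose: it produces an enumeration of the support, without
-- which a run could not leave the `input` state.

private variable
  n i k N : ℕ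

xor-≡ : ∀ x y → x xor y ≡ false → x ≡ y
xor-≡ false false _ = refl
xor-≡ true  true  _ = refl

xor-cancelˡ : ∀ x y → x xor (x xor y) ≡ y
xor-cancelˡ x y = trans (sym (xor-assoc x x y)) (cong (_xor y) (xor-same x))

xor-swap : ∀ x y z → x xor (y xor z) ≡ y xor (x xor z)
xor-swap = solve 3 (λ x y z → x :+ (y :+ z) := y :+ (x :+ z)) refl
  where open xor-∧-Solver

-- Sums over 𝔽₂

module _ {A : Set} where

  xorSum : (A → Bool) → List A → Bool
  xorSum φ xs = List.foldr _xor_ false (List.map φ xs)

  xorSum-++ : ∀ φ xs ys → xorSum φ (xs List.++ ys) ≡ xorSum φ xs xor xorSum φ ys
  xorSum-++ φ []       ys = refl
  xorSum-++ φ (x ∷ xs) ys =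
    trans (cong (φ x xor_) (xorSum-++ φ xs ys)) (sym (xor-assoc (φ x) _ _))

  xorSum-cong : ∀ {φ ψ} → (∀ x → φ x ≡ ψ x) → ∀ xs → xorSum φ xs ≡ xorSum ψ xs
  xorSum-cong φ≗ψ xs = cong (List.foldr _xor_ false) (List.map-cong φ≗ψ xs)

  xorSum-zero : ∀ {φ xs} → All (λ x → φ x ≡ false) xs → xorSum φ xs ≡ false
  xorSum-zero []         = refl
  xorSum-zero (px ∷ pxs) = cong₂ _xor_ px (xorSum-zero pxs)

  -- Used twice: with `φ` picking out one monomial, and with `φ` evaluating terms at a point where
  -- only one of them survives.
  xorSum-unique : ∀ {φ x xs} → Unique xs → x ∈ₗ xs → φ x ≡ true →
                  (∀ {y} → y ∈ₗ xs → y ≢ x → φ y ≡ false) → xorSum φ xs ≡ true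
  xorSum-unique {xs = _ ∷ xs} (x∉ ∷ _) (here refl) φx others =
    cong₂ _xor_ φx (xorSum-zero {xs = xs} (All.tabulate λ y∈ →
      others (there y∈) (λ y≡x → All.lookup x∉ y∈ (sym y≡x))))
  xorSum-unique (y∉ ∷ u) (there x∈) φx others =
    cong₂ _xor_ (others (here refl) (All.lookup y∉ x∈))
                (xorSum-unique u x∈ φx (others ∘ there))

xorSum-map : ∀ {A B : Set} (φ : B → Bool) (g : A → B) xs →
             xorSum φ (List.map g xs) ≡ xorSum (φ ∘ g) xs
xorSum-map φ g xs = cong (List.foldr _xor_ false) (sym (List.map-∘ xs))

module Reduce {A : Set} (_≟_ : DecidableEquality A) where

  -- Addition modulo 2: an entry already present cancels instead of being repeated. Sums over 𝔽₂ do
  -- not notice.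
  toggle : A → List A → List A
  toggle x [] = x ∷ []
  toggle x (y ∷ ys) with x ≟ y
  ... | yes _ = ys
  ... | no  _ = y ∷ toggle x ys

  xorSum-toggle : ∀ φ x ys → xorSum φ (toggle x ys) ≡ φ x xor xorSum φ ys
  xorSum-toggle φ x [] = refl
  xorSum-toggle φ x (y ∷ ys) with x ≟ y
  ... | yes refl = sym (xor-cancelˡ (φ x) _)
  ... | no  _    = trans (cong (φ y xor_) (xorSum-toggle φ x ys)) (xor-swap (φ y) (φ x) _)

  toggle-All : ∀ {P : A → Set} {x ys} → P x → All P ys → All P (toggle x ys)
  toggle-All px [] = px ∷ []
  toggle-All {x = x} px (_∷_ {x = y} py pys) with x ≟ y
  ... | yes _ = pys
  ... | no  _ = py ∷ toggle-All px pys

  toggle-Unique : ∀ {x ys} → Unique ys → Unique (toggle x ys)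
  toggle-Unique [] = [] ∷ []
  toggle-Unique {x} (_∷_ {x = y} y∉ u) with x ≟ y
  ... | yes _  = u
  ... | no x≢y = toggle-All (x≢y ∘ sym) y∉ ∷ toggle-Unique u

  reduce : List A → List A
  reduce = List.foldr toggle []

  xorSum-reduce : ∀ φ xs → xorSum φ (reduce xs) ≡ xorSum φ xs
  xorSum-reduce φ []       = refl
  xorSum-reduce φ (x ∷ xs) =
    trans (xorSum-toggle φ x (reduce xs)) (cong (φ x xor_) (xorSum-reduce φ xs))

  reduce-Unique : ∀ xs → Unique (reduce xs)
  reduce-Unique []       = []
  reduce-Unique (x ∷ xs) = toggle-Unique (reduce-Unique xs)

-- Evaluation

_≟ₘ_ : DecidableEquality (Monomial N)
_≟ₘ_ = Vec.≡-dec ℕ._≟_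

coeff-self : (m : Monomial N) → does (m ≟ₘ m) ≡ true
coeff-self m with m ≟ₘ m
... | yes _  = refl
... | no m≢m = contradiction refl m≢m

coeff-other : {m m′ : Monomial N} → m′ ≢ m → does (m′ ≟ₘ m) ≡ false
coeff-other {m = m} {m′} m′≢m with m′ ≟ₘ m
... | yes m′≡m = contradiction m′≡m m′≢m
... | no _     = refl

module _ {N : ℕ} where
  open Reduce (_≟ₘ_ {N})

  -- A repetition-free list with only zero coefficients is empty, so after
  -- reduction nothing is left of a zero polynomial.
  coeff-zero⇒xorSum-zero : ∀ (f : Poly N) → (∀ m → coeff f m ≡ false) →
                           ∀ φ → xorSum φ f ≡ false
  coeff-zero⇒xorSum-zero f zeros φ =
    trans (sym (xorSum-reduce φ f))
      (empty (reduce f) (reduce-Unique f) (λ m → trans (xorSum-reduce _ f) (zeros m)))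
    where
    empty : ∀ g → Unique g → (∀ m → coeff g m ≡ false) → xorSum φ g ≡ false
    empty []      _ _ = refl
    empty (m ∷ g) u z = contradiction
      (trans (sym (z m)) (xorSum-unique u (here refl) (coeff-self m) (λ _ → coeff-other)))
      λ()

  -- In characteristic 2 the list `f ++ g` is the difference, and its coefficients vanish. With `φ`
  -- the evaluation at a point, this makes `eval` well defined on 𝔽₂[X].
  coeff-≡⇒xorSum-≡ : ∀ (f g : Poly N) → (∀ m → coeff f m ≡ coeff g m) →
                     ∀ φ → xorSum φ f ≡ xorSum φ g
  coeff-≡⇒xorSum-≡ f g f≡g φ = xor-≡ _ _ (trans (sym (xorSum-++ φ f g))
    (coeff-zero⇒xorSum-zero (f List.++ g)
      (λ m → trans (xorSum-++ _ f g) (trans (cong (_xor coeff g m) (f≡g m)) (xor-same (coeff g m)))) φ))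

^-+ : ∀ b k l → b ^ (k ℕ.+ l) ≡ b ^ k ∧ b ^ l
^-+ b zero    l = refl
^-+ b (suc k) l = trans (cong (b ∧_) (^-+ b k l)) (sym (∧-assoc b _ _))

∧-swap : ∀ x y z → x ∧ (y ∧ z) ≡ y ∧ (x ∧ z)
∧-swap = solve 3 (λ x y z → x :* (y :* z) := y :* (x :* z)) refl
  where open xor-∧-Solver

∧-interchange : ∀ a b c d → (a ∧ b) ∧ (c ∧ d) ≡ (a ∧ c) ∧ (b ∧ d)
∧-interchange = solve 4 (λ a b c d → (a :* b) :* (c :* d) := (a :* c) :* (b :* d)) refl
  where open xor-∧-Solver

evalMonomial-+ : ∀ (p : Point N) l m →
  evalMonomial p (Vec.zipWith ℕ._+_ l m) ≡ evalMonomial p l ∧ evalMonomial p m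
evalMonomial-+ []      []      []      = refl
evalMonomial-+ (b ∷ p) (k ∷ l) (j ∷ m) =
  trans (cong₂ _∧_ (^-+ b k j) (evalMonomial-+ p l m)) (∧-interchange (b ^ k) (b ^ j) _ _)

evalMonomial-0 : ∀ (p : Point N) → evalMonomial p (Vec.replicate N 0) ≡ true
evalMonomial-0 []      = refl
evalMonomial-0 (b ∷ p) = evalMonomial-0 p

eval-+ : ∀ (p : Point N) f g → eval p (f + g) ≡ eval p f xor eval p g
eval-+ p = xorSum-++ (evalMonomial p)

eval-* : ∀ (p : Point N) f g → eval p (f * g) ≡ eval p f ∧ eval p g
eval-* p []      g = refl
eval-* p (m ∷ f) g = begin
  eval p (List.map (Vec.zipWith ℕ._+_ m) g List.++ f * g)
    ≡⟨ xorSum-++ _ (List.map (Vec.zipWith ℕ._+_ m) g) (f * g) ⟩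
  eval p (List.map (Vec.zipWith ℕ._+_ m) g) xor eval p (f * g)
    ≡⟨ cong₂ _xor_ (monomial g) (eval-* p f g) ⟩
  (evalMonomial p m ∧ eval p g) xor (eval p f ∧ eval p g)
    ≡⟨ ∧-distribʳ-xor (eval p g) (evalMonomial p m) (eval p f) ⟨
  (evalMonomial p m xor eval p f) ∧ eval p g ∎
  where
  open ≡-Reasoning
  monomial : ∀ g → eval p (List.map (Vec.zipWith ℕ._+_ m) g) ≡ evalMonomial p m ∧ eval p g
  monomial []      = sym (∧-zeroʳ _)
  monomial (l ∷ g) = trans (cong₂ _xor_ (evalMonomial-+ p m l) (monomial g))
                           (sym (∧-distribˡ-xor (evalMonomial p m) _ _))

eval-1 : ∀ (p : Point N) → eval p 1# ≡ true
eval-1 p = trans (xor-identityʳ _) (evalMonomial-0 p)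

monomial : Term N → Monomial N
monomial = Vec.map (λ b → if b then 1 else 0)

evalTerm : Point N → Term N → Bool
evalTerm p t = evalMonomial p (monomial t)

evalTerm-⊥ : ∀ (p : Point N) → evalTerm p Subset.⊥ ≡ true
evalTerm-⊥ []      = refl
evalTerm-⊥ (b ∷ p) = evalTerm-⊥ p

evalTerm-⁅⁆ : ∀ (p : Point N) u → evalTerm p ⁅ u ⁆ ≡ lookup p u
evalTerm-⁅⁆ (b ∷ p) zero    =
  trans (cong₂ _∧_ (∧-identityʳ b) (evalTerm-⊥ p)) (∧-identityʳ b)
evalTerm-⁅⁆ (b ∷ p) (suc u) = evalTerm-⁅⁆ p u

eval-term : ∀ (p : Point N) t → eval p (term t) ≡ evalTerm p t
eval-term p t = xor-identityʳ _

eval-X : ∀ (p : Point N) u → eval p (X u) ≡ lookup p u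
eval-X p u = trans (eval-term p ⁅ u ⁆) (evalTerm-⁅⁆ p u)

evalTerm-remove : ∀ (p : Point N) {t u} → u Subset.∈ t →
                  evalTerm p t ≡ lookup p u ∧ evalTerm p (t Subset.- u)
evalTerm-remove (b ∷ p) {_ ∷ t} {zero} Vec.here =
  cong₂ _∧_ (∧-identityʳ b) (cong (evalTerm p) (sym (p─⊥≡p t)))
evalTerm-remove (b ∷ p) {c ∷ t} {suc u} (Vec.there u∈t) =
  trans (cong (c′ ∧_) (evalTerm-remove p u∈t))
    (trans (sym (∧-assoc c′ (lookup p u) _))
      (trans (cong (_∧ evalTerm p (t Subset.- u)) (∧-comm c′ _)) (∧-assoc (lookup p u) c′ _)))
  where c′ = b ^ (if c then 1 else 0)

-- Terms and points are both boolean vectors, so `t` also serves as the indicator point of its own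
-- indeterminates. There `evalTerm t s` is true exactly when `s` divides `t`.
evalTerm-self : ∀ (t : Term N) → evalTerm t t ≡ true
evalTerm-self []            = refl
evalTerm-self (inside  ∷ t) = evalTerm-self t
evalTerm-self (outside ∷ t) = evalTerm-self t

evalTerm⇒deg-≤ : ∀ (t s : Term N) → evalTerm t s ≡ true → deg s ℕ.≤ deg t
evalTerm⇒deg-≤ []            []            _  = z≤n
evalTerm⇒deg-≤ (inside  ∷ t) (inside  ∷ s) eq = s≤s (evalTerm⇒deg-≤ t s eq)
evalTerm⇒deg-≤ (inside  ∷ t) (outside ∷ s) eq = ℕ.m≤n⇒m≤1+n (evalTerm⇒deg-≤ t s eq)
evalTerm⇒deg-≤ (outside ∷ t) (outside ∷ s) eq = evalTerm⇒deg-≤ t s eq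

-- A proper divisor has strictly smaller degree, which gives `vanishing⇒empty` its induction on the
-- degree.
evalTerm⇒≡⊎deg-< : ∀ (t s : Term N) → evalTerm t s ≡ true → s ≡ t ⊎ deg s ℕ.< deg t
evalTerm⇒≡⊎deg-< []            []            _  = inj₁ refl
evalTerm⇒≡⊎deg-< (inside  ∷ t) (outside ∷ s) eq = inj₂ (s≤s (evalTerm⇒deg-≤ t s eq))
evalTerm⇒≡⊎deg-< (inside  ∷ t) (inside  ∷ s) eq with evalTerm⇒≡⊎deg-< t s eq
... | inj₁ s≡t = inj₁ (cong (inside ∷_) s≡t)
... | inj₂ s<t = inj₂ (s≤s s<t)
evalTerm⇒≡⊎deg-< (outside ∷ t) (outside ∷ s) eq with evalTerm⇒≡⊎deg-< t s eq
... | inj₁ s≡t = inj₁ (cong (outside ∷_) s≡t)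
... | inj₂ s<t = inj₂ s<t

-- Boolean polynomials are Boolean functions

FieldIdeal : ∀ {N} → Pred (Poly N) _
FieldIdeal {N} = Ideal (𝔽₂[X] N) (λ f → ∃[ i ] f ≡ fieldEquation i)

infix 4 _≐_

_≐_ : BoolPoly N → BoolPoly N → Set
f ≐ g = ∀ p → eval p f ≡ eval p g

eval-FieldIdeal : ∀ {f : Poly N} → f ∈ FieldIdeal → ∀ p → eval p f ≡ false
eval-FieldIdeal (gen (u , refl)) p =
  trans (eval-+ p (X u * X u) (X u))
    (trans (cong (_xor eval p (X u)) (trans (eval-* p (X u) (X u)) (Bool.∧-idem (eval p (X u)))))
      (xor-same (eval p (X u))))
eval-FieldIdeal 0∈ p = refl
eval-FieldIdeal (+∈ {a} {b} a∈ b∈) p =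
  trans (eval-+ p a b) (cong₂ _xor_ (eval-FieldIdeal a∈ p) (eval-FieldIdeal b∈ p))
eval-FieldIdeal (*∈ r {a} a∈) p =
  trans (eval-* p r a) (trans (cong (eval p r ∧_) (eval-FieldIdeal a∈ p)) (∧-zeroʳ _))
eval-FieldIdeal (resp {a} {b} a≈b a∈) p =
  trans (sym (coeff-≡⇒xorSum-≡ a b a≈b _)) (eval-FieldIdeal a∈ p)

≈⇒≐ : ∀ (f g : BoolPoly N) → f ≈ g → f ≐ g
≈⇒≐ f g f≈g p = xor-≡ _ _ (trans (sym (eval-+ p f g)) (eval-FieldIdeal f≈g p))

-- The nontrivial inclusion between the zeros of `f` and those of the ideal it generates. Here
-- `resp` moves along equality in 𝔹, hence the use of `≈⇒≐`.
eval-Ideal : ∀ {f g : BoolPoly N} → g ∈ ⟨ f ⟩ → ∀ p → eval p f ≡ false → eval p g ≡ false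
eval-Ideal (gen refl) p z = z
eval-Ideal 0∈ p z = refl
eval-Ideal (+∈ {a} {b} a∈ b∈) p z =
  trans (eval-+ p a b) (cong₂ _xor_ (eval-Ideal a∈ p z) (eval-Ideal b∈ p z))
eval-Ideal (*∈ r {a} a∈) p z =
  trans (eval-* p r a) (trans (cong (eval p r ∧_) (eval-Ideal a∈ p z)) (∧-zeroʳ _))
eval-Ideal (resp {a} {b} a≈b a∈) p z =
  trans (sym (≈⇒≐ a b a≈b p)) (eval-Ideal a∈ p z)

-- Negation is the identity, so `f ++ g ∈ FieldIdeal` is what `f ≈ g` in 𝔹 unfolds to. The two
-- copies of `g` cancel.
FieldIdeal-trans : ∀ (f g h : Poly N) → f List.++ g ∈ FieldIdeal → g List.++ h ∈ FieldIdeal →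
                   f List.++ h ∈ FieldIdeal
FieldIdeal-trans f g h fg gh = resp coeffs (+∈ fg gh)
  where
  open ≡-Reasoning
  coeffs : ∀ m → coeff ((f List.++ g) List.++ (g List.++ h)) m ≡ coeff (f List.++ h) m
  coeffs m = begin
    coeff ((f List.++ g) List.++ (g List.++ h)) m
      ≡⟨ xorSum-++ _ (f List.++ g) (g List.++ h) ⟩
    coeff (f List.++ g) m xor coeff (g List.++ h) m
      ≡⟨ cong₂ _xor_ (xorSum-++ _ f g) (xorSum-++ _ g h) ⟩
    (coeff f m xor coeff g m) xor (coeff g m xor coeff h m)
      ≡⟨ xor-assoc (coeff f m) (coeff g m) _ ⟩
    coeff f m xor (coeff g m xor (coeff g m xor coeff h m))
      ≡⟨ cong (coeff f m xor_) (xor-cancelˡ (coeff g m) _) ⟩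
    coeff f m xor coeff h m
      ≡⟨ xorSum-++ _ f h ⟨
    coeff (f List.++ h) m ∎

FieldIdeal-refl : ∀ (f : Poly N) → f List.++ f ∈ FieldIdeal
FieldIdeal-refl f = resp (λ m → sym (trans (xorSum-++ _ f f) (xor-same (coeff f m)))) 0∈

-- Reduction of monomials to square-free terms

infix 4 _↝_

-- Replaces X² by X once inside a monomial. Asking for an exponent of at least 2 keeps the
-- indeterminate present.
data _↝_ : Monomial N → Monomial N → Set where
  here  : {m : Monomial N} → suc (suc k) ∷ m ↝ suc k ∷ m
  there : {m m′ : Monomial N} → m ↝ m′ → k ∷ m ↝ k ∷ m′

+-monomial-⊥ : ∀ (m : Monomial N) → Vec.zipWith ℕ._+_ m (monomial Subset.⊥) ≡ m
+-monomial-⊥ m = trans (cong (Vec.zipWith ℕ._+_ m) (Vec.map-replicate _ _ _))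
                       (Vec.zipWith-identityʳ ℕ.+-identityʳ m)

-- With `r` the cofactor, `m` is r Xᵤ² and `m′` is r Xᵤ, so their sum is `r` times a field equation,
-- already as a list.
↝-shape : {m m′ : Monomial N} → m ↝ m′ → ∃[ u ] ∃[ r ]
          Vec.zipWith ℕ._+_ r (Vec.zipWith ℕ._+_ (monomial ⁅ u ⁆) (monomial ⁅ u ⁆)) ≡ m
          × Vec.zipWith ℕ._+_ r (monomial ⁅ u ⁆) ≡ m′
↝-shape {m = _ ∷ m} (here {k = k}) = zero , k ∷ m ,
  cong₂ _∷_ (ℕ.+-comm k 2)
    (trans (cong (Vec.zipWith ℕ._+_ m) (+-monomial-⊥ _)) (+-monomial-⊥ m)) ,
  cong₂ _∷_ (ℕ.+-comm k 1) (+-monomial-⊥ m)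
↝-shape (there {k = k} m↝m′) with ↝-shape m↝m′
... | u , r , refl , refl = suc u , k ∷ r ,
  cong (_∷ _) (ℕ.+-identityʳ k) , cong (_∷ _) (ℕ.+-identityʳ k)

↝-FieldIdeal : {m m′ : Monomial N} → m ↝ m′ → m ∷ m′ ∷ [] ∈ FieldIdeal
↝-FieldIdeal m↝m′ with ↝-shape m↝m′
... | u , r , refl , refl = *∈ (r ∷ []) (gen (u , refl))

↝*-FieldIdeal : {m m′ : Monomial N} → Star _↝_ m m′ → m ∷ m′ ∷ [] ∈ FieldIdeal
↝*-FieldIdeal {m = m} ε = FieldIdeal-refl (m ∷ [])
↝*-FieldIdeal {m = m} {m′} (_◅_ {j = l} m↝l l↝*m′) =
  FieldIdeal-trans (m ∷ []) (l ∷ []) (m′ ∷ []) (↝-FieldIdeal m↝l) (↝*-FieldIdeal l↝*m′)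

radical : Monomial N → Term N
radical = Vec.map λ { zero → outside ; (suc _) → inside }

↝*-radical : ∀ (m : Monomial N) → Star _↝_ m (monomial (radical m))
↝*-radical []      = ε
↝*-radical (k ∷ m) = Star.gmap (k ∷_) there (↝*-radical m) ◅◅ exponent k
  where
  -- The target is phrased through `radical (k ∷ [])` because the map on exponents inside `radical`
  -- has no name.
  exponent : ∀ k {m : Monomial N} → Star _↝_ (k ∷ m) (monomial (radical (k ∷ [])) ++ m)
  exponent zero          = ε
  exponent (suc zero)    = ε
  exponent (suc (suc k)) = here ◅ exponent (suc k)

_≟ₜ_ : DecidableEquality (Term N)
_≟ₜ_ = Vec.≡-dec Bool._≟_

open Reduce using (reduce; reduce-Unique; xorSum-reduce)

support : BoolPoly N → List (Term N)
support f = reduce _≟ₜ_ (List.map radical f)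

sumOfTerms : List (Term N) → BoolPoly N
sumOfTerms L = List.foldr _+_ 0# (List.map term L)

sumOfTerms-map : ∀ (L : List (Term N)) → sumOfTerms L ≡ List.map monomial L
sumOfTerms-map []      = refl
sumOfTerms-map (t ∷ L) = cong (monomial t ∷_) (sumOfTerms-map L)

xorSum-sumOfTerms : ∀ φ (L : List (Term N)) → xorSum φ (sumOfTerms L) ≡ xorSum (φ ∘ monomial) L
xorSum-sumOfTerms φ L = trans (cong (xorSum φ) (sumOfTerms-map L)) (xorSum-map φ monomial L)

xorSum-support : ∀ φ (f : BoolPoly N) →
  xorSum φ (sumOfTerms (support f)) ≡ xorSum φ (List.map (monomial ∘ radical) f)
xorSum-support φ f = begin
  xorSum φ (sumOfTerms (support f))
    ≡⟨ xorSum-sumOfTerms φ (support f) ⟩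
  xorSum (φ ∘ monomial) (reduce _≟ₜ_ (List.map radical f))
    ≡⟨ xorSum-reduce _≟ₜ_ (φ ∘ monomial) (List.map radical f) ⟩
  xorSum (φ ∘ monomial) (List.map radical f)
    ≡⟨ xorSum-map (φ ∘ monomial) radical f ⟩
  xorSum (φ ∘ monomial ∘ radical) f
    ≡⟨ xorSum-map φ (monomial ∘ radical) f ⟨
  xorSum φ (List.map (monomial ∘ radical) f) ∎
  where open ≡-Reasoning

radical-FieldIdeal : ∀ (f : Poly N) → f List.++ List.map (monomial ∘ radical) f ∈ FieldIdeal
radical-FieldIdeal []      = 0∈
radical-FieldIdeal (m ∷ f) =
  resp (λ l → coeffs (λ m′ → does (m′ ≟ₘ l)))
       (+∈ (↝*-FieldIdeal (↝*-radical m)) (radical-FieldIdeal f))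
  where
  f′ = List.map (monomial ∘ radical) f
  m′ = monomial (radical m)
  open ≡-Reasoning
  coeffs : ∀ φ → xorSum φ (m ∷ m′ ∷ f List.++ f′) ≡ xorSum φ ((m ∷ f) List.++ (m′ ∷ f′))
  coeffs φ = begin
    φ m xor (φ m′ xor xorSum φ (f List.++ f′))
      ≡⟨ cong (λ s → φ m xor (φ m′ xor s)) (xorSum-++ φ f f′) ⟩
    φ m xor (φ m′ xor (xorSum φ f xor xorSum φ f′))
      ≡⟨ cong (φ m xor_) (xor-swap (φ m′) (xorSum φ f) (xorSum φ f′)) ⟩
    φ m xor (xorSum φ f xor (φ m′ xor xorSum φ f′))
      ≡⟨ cong (φ m xor_) (xorSum-++ φ f (m′ ∷ f′)) ⟨
    φ m xor xorSum φ (f List.++ (m′ ∷ f′)) ∎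

support-isSupport : ∀ (f : BoolPoly N) → IsSupport f (support f)
support-isSupport f = reduce-Unique _≟ₜ_ (List.map radical f) , resp coeffs (radical-FieldIdeal f)
  where
  f′ = List.map (monomial ∘ radical) f
  coeffs : ∀ m → coeff (f List.++ f′) m ≡ coeff (f List.++ sumOfTerms (support f)) m
  coeffs m = trans (xorSum-++ _ f f′)
    (trans (cong (coeff f m xor_) (sym (xorSum-support _ f)))
      (sym (xorSum-++ _ f (sumOfTerms (support f)))))

eval-support : ∀ (f : BoolPoly N) {L} → IsSupport f L → ∀ p → eval p f ≡ xorSum (evalTerm p) L
eval-support f {L} (_ , f≈) p =
  trans (≈⇒≐ f (sumOfTerms L) f≈ p) (xorSum-sumOfTerms (evalMonomial p) L)

-- At the point t, every other term of degree at least deg t vanishes, so a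
-- term of minimal degree cannot be cancelled.
vanishing⇒empty : ∀ (L : List (Term N)) → Unique L →
                  (∀ p → xorSum (evalTerm p) L ≡ false) → L ≡ []
vanishing⇒empty []      _ _ = refl
vanishing⇒empty (s ∷ L) u z = contradiction (here refl) (absent s (<-wellFounded _))
  where
  absent : ∀ t → Acc ℕ._<_ (deg t) → t ∉ s ∷ L
  absent t (acc rs) t∈ = contradiction
    (trans (sym (z t)) (xorSum-unique u t∈ (evalTerm-self t) others)) λ()
    where
    others : ∀ {r} → r ∈ₗ s ∷ L → r ≢ t → evalTerm t r ≡ false
    others {r} r∈ r≢t with evalTerm t r in eq
    ... | false = refl
    ... | true with evalTerm⇒≡⊎deg-< t r eq
    ...   | inj₁ r≡t = contradiction r≡t r≢t
    ...   | inj₂ r<t = contradiction r∈ (absent r (rs r<t))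

-- The difference vanishes at every point, so its support is empty; being congruent to the sum over
-- its support, it lies in the ideal.
≐⇒≈ : ∀ (f g : BoolPoly N) → f ≐ g → f ≈ g
≐⇒≈ f g f≐g = subst (_∈ FieldIdeal) (List.++-identityʳ h)
  (subst (λ L → h List.++ sumOfTerms L ∈ FieldIdeal) empty (proj₂ isSupp))
  where
  h = f List.++ g
  isSupp = support-isSupport h
  empty : support h ≡ []
  empty = vanishing⇒empty (support h) (proj₁ isSupp) λ p →
    trans (sym (eval-support h isSupp p))
      (trans (eval-+ p f g) (trans (cong (_xor eval p g) (f≐g p)) (xor-same (eval p g))))

≈-refl : ∀ (f : BoolPoly N) → f ≈ f
≈-refl f = ≐⇒≈ f f λ _ → refl

-- Linear polynomials

-- The family is arbitrary because the inductions below drop its first member, and what remains of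
-- `X` is no longer of the form `X`.
combination : (Fin k → Bool) → (Fin k → BoolPoly N) → BoolPoly N
combination a G = sum (λ j → a j · G j)

combination-false : ∀ (G : Fin k → BoolPoly N) {a} → (∀ j → a j ≡ false) → combination a G ≡ []
combination-false {zero}  G a≡ = refl
combination-false {suc k} G {a} a≡ = cong₂ _+_ (cong (_· G zero) (a≡ zero))
                                              (combination-false (G ∘ suc) (a≡ ∘ suc))

combination-⁅⁆ : ∀ (G : Fin k → BoolPoly N) u → combination (lookup ⁅ u ⁆) G ≡ G u
combination-⁅⁆ G zero    =
  trans (cong (G zero +_) (combination-false (G ∘ suc) λ j → Vec.lookup-replicate j false))
        (List.++-identityʳ _)
combination-⁅⁆ G (suc u) = combination-⁅⁆ (G ∘ suc) u

eval-· : ∀ (p : Point N) c f → eval p (c · f) ≡ c ∧ eval p f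
eval-· p true  f = refl
eval-· p false f = refl

-- Fails for the lists themselves: where `a j` and `b j` are both true, the right side adds `G j`
-- twice and the left side not at all.
eval-combination-xor : ∀ (p : Point N) (G : Fin k → BoolPoly N) a b →
  eval p (combination (λ j → a j xor b j) G) ≡
  eval p (combination a G) xor eval p (combination b G)
eval-combination-xor {k = zero}  p G a b = refl
eval-combination-xor {k = suc k} p G a b = begin
  eval p ((a₀ xor b₀) · G zero + rest (λ j → a j xor b j))
    ≡⟨ eval-+ p ((a₀ xor b₀) · G zero) _ ⟩
  eval p ((a₀ xor b₀) · G zero) xor eval p (rest (λ j → a j xor b j))
    ≡⟨ cong₂ _xor_ (eval-· p (a₀ xor b₀) (G zero))
                   (eval-combination-xor p (G ∘ suc) (a ∘ suc) (b ∘ suc)) ⟩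
  ((a₀ xor b₀) ∧ g) xor (eval p (rest a) xor eval p (rest b))
    ≡⟨ solve 5 (λ x y g r s → (x :+ y) :* g :+ (r :+ s) := (x :* g :+ r) :+ (y :* g :+ s))
         refl a₀ b₀ g (eval p (rest a)) (eval p (rest b)) ⟩
  ((a₀ ∧ g) xor eval p (rest a)) xor ((b₀ ∧ g) xor eval p (rest b))
    ≡⟨ cong₂ _xor_ (unfold a) (unfold b) ⟨
  eval p (combination a G) xor eval p (combination b G) ∎
  where
  open ≡-Reasoning
  open xor-∧-Solver
  a₀ = a zero
  b₀ = b zero
  g  = eval p (G zero)
  rest : (Fin (suc k) → Bool) → BoolPoly _
  rest c = combination (c ∘ suc) (G ∘ suc)
  unfold : ∀ c → eval p (combination c G) ≡ (c zero ∧ g) xor eval p (rest c)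
  unfold c = trans (eval-+ p (c zero · G zero) (rest c))
                   (cong (_xor eval p (rest c)) (eval-· p (c zero) (G zero)))

affine : Bool → (Fin N → Bool) → BoolPoly N
affine c a = c · 1# + combination a X

linear : ∀ (f : BoolPoly N) c a → f ≐ affine c a → Linear f
linear f c a f≐ = c , a , ≐⇒≈ f (affine c a) f≐

linear-≐ : ∀ (f g : BoolPoly N) → f ≐ g → Linear g → Linear f
linear-≐ f g f≐g (c , a , g≈) =
  linear f c a λ p → trans (f≐g p) (≈⇒≐ g (affine c a) g≈ p)

linear-0 : Linear {N} 0#
linear-0 = linear 0# false (λ _ → false) λ p →
  cong (eval p) (sym (combination-false X λ _ → refl))

linear-1 : Linear {N} 1#
linear-1 = linear 1# true (λ _ → false) λ p →
  sym (trans (eval-+ p 1# (combination (λ _ → false) X))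
    (trans (cong (λ f → eval p 1# xor eval p f) (combination-false X λ _ → refl))
      (xor-identityʳ _)))

linear-X : ∀ (u : Fin N) → Linear (X u)
linear-X u = linear (X u) false (lookup ⁅ u ⁆) λ p →
  cong (eval p) (sym (combination-⁅⁆ X u))

linear-+ : ∀ (f g : BoolPoly N) → Linear f → Linear g → Linear (f + g)
linear-+ f g (c , a , f≈) (d , b , g≈) =
  linear (f + g) (c xor d) (λ j → a j xor b j) λ p → begin
    eval p (f + g)
      ≡⟨ eval-+ p f g ⟩
    eval p f xor eval p g
      ≡⟨ cong₂ _xor_ (≈⇒≐ f (affine c a) f≈ p) (≈⇒≐ g (affine d b) g≈ p) ⟩
    eval p (affine c a) xor eval p (affine d b)
      ≡⟨ cong₂ _xor_ (unfold p c a) (unfold p d b) ⟩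
    ((c ∧ eval p 1#) xor eval p (combination a X)) xor ((d ∧ eval p 1#) xor eval p (combination b X))
      ≡⟨ solve 5 (λ x y g r s → (x :* g :+ r) :+ (y :* g :+ s) := (x :+ y) :* g :+ (r :+ s))
           refl c d (eval p 1#) (eval p (combination a X)) (eval p (combination b X)) ⟩
    ((c xor d) ∧ eval p 1#) xor (eval p (combination a X) xor eval p (combination b X))
      ≡⟨ cong (((c xor d) ∧ eval p 1#) xor_) (eval-combination-xor p X a b) ⟨
    ((c xor d) ∧ eval p 1#) xor eval p (combination (λ j → a j xor b j) X)
      ≡⟨ unfold p (c xor d) (λ j → a j xor b j) ⟨
    eval p (affine (c xor d) (λ j → a j xor b j)) ∎
  where
  open ≡-Reasoning
  open xor-∧-Solver
  unfold : ∀ p c a → eval p (affine c a) ≡ (c ∧ eval p 1#) xor eval p (combination a X)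
  unfold p c a = trans (eval-+ p (c · 1#) (combination a X))
                       (cong (_xor eval p (combination a X)) (eval-· p c 1#))

deg≡0⇒⊥ : ∀ (t : Term N) → deg t ℕ.≤ 0 → t ≡ Subset.⊥
deg≡0⇒⊥ []            _  = refl
deg≡0⇒⊥ (outside ∷ t) t≤ = cong (outside ∷_) (deg≡0⇒⊥ t t≤)

deg≤1⇒⊥⊎⁅⁆ : ∀ (t : Term N) → deg t ℕ.≤ 1 → t ≡ Subset.⊥ ⊎ ∃[ u ] t ≡ ⁅ u ⁆
deg≤1⇒⊥⊎⁅⁆ []            _        = inj₁ refl
deg≤1⇒⊥⊎⁅⁆ (inside  ∷ t) (s≤s t≤) = inj₂ (zero , cong (inside ∷_) (deg≡0⇒⊥ t t≤))
deg≤1⇒⊥⊎⁅⁆ (outside ∷ t) t≤ with deg≤1⇒⊥⊎⁅⁆ t t≤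
... | inj₁ t≡       = inj₁ (cong (outside ∷_) t≡)
... | inj₂ (u , t≡) = inj₂ (suc u , cong (outside ∷_) t≡)

linear-term : ∀ (t : Term N) → deg t ℕ.≤ 1 → Linear (term t)
linear-term t t≤1 with deg≤1⇒⊥⊎⁅⁆ t t≤1
... | inj₂ (u , refl) = linear-X u
... | inj₁ refl       = linear-≐ (term t) 1#
  (λ p → trans (eval-term p Subset.⊥) (trans (evalTerm-⊥ p) (sym (eval-1 p)))) linear-1

-- Keeps the while loop from getting stuck: above degree 1 the rule `body` always finds its ℓ₁ and
-- ℓ₂.
deg>1⇒two : ∀ (t : Term N) → 1 ℕ.< deg t → ∃[ u ] ∃[ v ] u ≢ v × u Subset.∈ t × v Subset.∈ t
deg>1⇒two (inside ∷ t) (s≤s 0<t) with deg>0⇒∈ t 0<t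
  where
  deg>0⇒∈ : ∀ (t : Term k) → 0 ℕ.< deg t → ∃[ u ] u Subset.∈ t
  deg>0⇒∈ (inside  ∷ t) _   = zero , Vec.here
  deg>0⇒∈ (outside ∷ t) 0<t with deg>0⇒∈ t 0<t
  ... | u , u∈t = suc u , Vec.there u∈t
... | u , u∈t = zero , suc u , (λ ()) , Vec.here , Vec.there u∈t
deg>1⇒two (outside ∷ t) 1<t with deg>1⇒two t 1<t
... | u , v , u≢v , u∈t , v∈t =
  suc u , suc v , (λ { refl → u≢v refl }) , Vec.there u∈t , Vec.there v∈t

-- Adjoining an indeterminate


module _ {A : Set} where

  take-extend : ∀ n {i} (a : A) (v : Vec A (n ℕ.+ i)) → take n (extend {n = n} a v) ≡ take n v
  take-extend zero    a v       = refl
  take-extend (suc n) a (x ∷ v) = cong (x ∷_) (take-extend n a v)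

  lookup-extend : ∀ n {i} (a : A) (v : Vec A (n ℕ.+ i)) →
                  lookup (extend {n = n} a v) (n ↑ʳ fromℕ i) ≡ a
  lookup-extend zero    a []      = refl
  lookup-extend zero    a (x ∷ v) = lookup-extend zero a v
  lookup-extend (suc n) a (x ∷ v) = lookup-extend n a v

  -- Reduces a claim about all points of the larger space to points of the form `extend a v`, at
  -- which `ι` can be evaluated.
  extend-surjective : ∀ n {i} (w : Vec A (n ℕ.+ suc i)) →
                      ∃[ a ] ∃[ v ] w ≡ extend {n = n} a v
  extend-surjective zero    w with Vec.initLast w
  ... | v , a , w≡ = a , v , w≡
  extend-surjective (suc n) (x ∷ w) with extend-surjective n w
  ... | a , v , refl = a , x ∷ v , refl

map-extend : ∀ {A B : Set} n {i} (g : A → B) a (v : Vec A (n ℕ.+ i)) →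
             Vec.map g (extend {n = n} a v) ≡ extend {n = n} (g a) (Vec.map g v)
map-extend zero    g a v       = Vec.map-∷ʳ g a v
map-extend (suc n) g a (x ∷ v) = cong (g x ∷_) (map-extend n g a v)

∣extend∣ : ∀ n {i} b (t : Subset (n ℕ.+ i)) → ∣ extend {n = n} b t ∣ ≡ ∣ b ∷ t ∣
∣extend∣ zero    b []             = refl
∣extend∣ zero    inside  (inside  ∷ t) = cong suc (∣extend∣ zero inside t)
∣extend∣ zero    outside (inside  ∷ t) = cong suc (∣extend∣ zero outside t)
∣extend∣ zero    inside  (outside ∷ t) = ∣extend∣ zero inside t
∣extend∣ zero    outside (outside ∷ t) = ∣extend∣ zero outside t
∣extend∣ (suc n) inside  (inside  ∷ t) = cong suc (∣extend∣ n inside t)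
∣extend∣ (suc n) outside (inside  ∷ t) = cong suc (∣extend∣ n outside t)
∣extend∣ (suc n) inside  (outside ∷ t) = ∣extend∣ n inside t
∣extend∣ (suc n) outside (outside ∷ t) = ∣extend∣ n outside t

-- The exponent `k` is 0 for polynomials coming through `ι`, where the factor is true, and 1 for
-- terms containing the new indeterminate.
evalMonomial-extend : ∀ n {i} b (p : Point (n ℕ.+ i)) k m →
  evalMonomial (extend {n = n} b p) (extend {n = n} k m) ≡ b ^ k ∧ evalMonomial p m
evalMonomial-extend zero    b []      k []      = refl
evalMonomial-extend zero    b (c ∷ p) k (j ∷ m) =
  trans (cong (c ^ j ∧_) (evalMonomial-extend zero b p k m)) (∧-swap (c ^ j) (b ^ k) _)
evalMonomial-extend (suc n) b (c ∷ p) k (j ∷ m) =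
  trans (cong (c ^ j ∧_) (evalMonomial-extend n b p k m)) (∧-swap (c ^ j) (b ^ k) _)

evalTerm-extend : ∀ n {i} b (p : Point (n ℕ.+ i)) t →
  evalTerm (extend {n = n} b p) (extend {n = n} inside t) ≡ b ∧ evalTerm p t
evalTerm-extend n b p t =
  trans (cong (evalMonomial (extend {n = n} b p)) (map-extend n _ inside t))
    (trans (evalMonomial-extend n b p 1 (monomial t)) (cong (_∧ evalTerm p t) (∧-identityʳ b)))

evalMonomial-++ : ∀ n {i} (p : Point (n ℕ.+ i)) l m →
  evalMonomial p (l ++ m) ≡ evalMonomial (take n p) l ∧ evalMonomial (drop n p) m
evalMonomial-++ zero    p       []      m = refl
evalMonomial-++ (suc n) (b ∷ p) (k ∷ l) m =
  trans (cong (b ^ k ∧_) (evalMonomial-++ n p l m)) (sym (∧-assoc (b ^ k) _ _))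

evalTerm-++-⊥ : ∀ n {i} (p : Point (n ℕ.+ i)) t →
                evalTerm p (t ++ Subset.⊥) ≡ evalTerm (take n p) t
evalTerm-++-⊥ n {i} p t =
  trans (cong (evalMonomial p) (Vec.map-++ _ t Subset.⊥))
    (trans (evalMonomial-++ n p (monomial t) (monomial Subset.⊥))
      (trans (cong (evalTerm (take n p) t ∧_) (evalTerm-⊥ (drop n p))) (∧-identityʳ _)))

eval-ι₀ : ∀ (p : Point (n ℕ.+ 0)) f → eval p (ι₀ f) ≡ eval (take n p) f
eval-ι₀ {n} p f = trans (xorSum-map (evalMonomial p) (_++ []) f) (xorSum-cong unpad f)
  where
  last-empty : ∀ (q : Point 0) → evalMonomial q [] ≡ true
  last-empty [] = refl
  unpad : ∀ m → evalMonomial p (m ++ []) ≡ evalMonomial (take n p) m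
  unpad m = trans (evalMonomial-++ n p m [])
    (trans (cong (evalMonomial (take n p) m ∧_) (last-empty (drop n p))) (∧-identityʳ _))

take-injective : ∀ n (p q : Point (n ℕ.+ 0)) → take n p ≡ take n q → p ≡ q
take-injective zero    []      []      _  = refl
take-injective (suc n) (b ∷ p) (c ∷ q) eq =
  cong₂ _∷_ (Vec.∷-injectiveˡ eq) (take-injective n p q (Vec.∷-injectiveʳ eq))

take-++-[] : ∀ n (p : Point n) → take n (p ++ []) ≡ p
take-++-[] zero    []      = refl
take-++-[] (suc n) (b ∷ p) = cong (b ∷_) (take-++-[] n p)

module Adjunction (n i : ℕ) where

  infixl 8 _▹_

  _▹_ : Point (n ℕ.+ i) → Bool → Point (n ℕ.+ suc i)
  p ▹ b = extend {n = n} b p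

  -- Fixes `n` and `i`, which cannot be inferred from their sum in the types.
  ι′ : BoolPoly₂ n i → BoolPoly₂ n (suc i)
  ι′ = ι {n} {i}

  eval-ι : ∀ b p f → eval (p ▹ b) (ι′ f) ≡ eval p f
  eval-ι b p f = trans (xorSum-map (evalMonomial (p ▹ b)) (extend {n = n} 0) f)
    (xorSum-cong (evalMonomial-extend n b p 0) f)

  ι-≐ : ∀ f g → f ≐ g → ι′ f ≐ ι′ g
  ι-≐ f g f≐g q with extend-surjective n q
  ... | b , p , refl = trans (eval-ι b p f) (trans (f≐g p) (sym (eval-ι b p g)))

  ι-* : ∀ f g → ι′ (f * g) ≐ ι′ f * ι′ g
  ι-* f g q with extend-surjective n q
  ... | b , p , refl = trans (eval-ι b p (f * g)) (trans (eval-* p f g)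
    (trans (sym (cong₂ _∧_ (eval-ι b p f) (eval-ι b p g))) (sym (eval-* (p ▹ b) (ι′ f) (ι′ g)))))

  -- Instead of locating the index of the image among the indeterminates of the larger ring,
  -- `ι′ (X u)` is seen as a term of degree 1.
  linear-ιX : ∀ u → Linear (ι′ (X u))
  linear-ιX u = subst (λ m → Linear (m ∷ [])) (map-extend n _ outside ⁅ u ⁆)
    (linear-term (extend {n = n} outside ⁅ u ⁆)
      (ℕ.≤-reflexive (trans (∣extend∣ n outside ⁅ u ⁆) (∣⁅x⁆∣≡1 u))))

  linear-ι1 : Linear (ι′ 1#)
  linear-ι1 = linear-≐ (ι′ 1#) 1# eq linear-1
    where
    eq : ι′ 1# ≐ 1#
    eq q with extend-surjective n q
    ... | b , p , refl = trans (eval-ι b p 1#) (trans (eval-1 p) (sym (eval-1 (p ▹ b))))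

  linear-ι· : ∀ c f → Linear (ι′ f) → Linear (ι′ (c · f))
  linear-ι· true  f lin = lin
  linear-ι· false f lin = linear-0

  linear-ι-+ : ∀ f g → Linear (ι′ f) → Linear (ι′ g) → Linear (ι′ (f + g))
  linear-ι-+ f g linf ling = subst Linear (sym (List.map-++ (extend {n = n} 0) f g))
    (linear-+ (ι′ f) (ι′ g) linf ling)

  linear-ι-combination : ∀ a (G : Fin k → BoolPoly₂ n i) → (∀ j → Linear (ι′ (G j))) →
                         Linear (ι′ (combination a G))
  linear-ι-combination {zero}  a G lin = linear-0
  linear-ι-combination {suc k} a G lin = linear-ι-+ (a zero · G zero) _
    (linear-ι· (a zero) (G zero) (lin zero)) (linear-ι-combination (a ∘ suc) (G ∘ suc) (lin ∘ suc))

  linear-ι : ∀ f → Linear f → Linear (ι′ f)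
  linear-ι f (c , a , f≈) = linear-≐ (ι′ f) (ι′ (affine c a))
    (ι-≐ f (affine c a) (≈⇒≐ f (affine c a) f≈))
    (linear-ι-+ (c · 1#) (combination a X) (linear-ι· c 1# linear-ι1) (linear-ι-combination a X linear-ιX))

  is2XNF-ι : ∀ {M} → Is2XNF M → Is2XNF (List.map ι′ M)
  is2XNF-ι xnf = All.map⁺ (All.map item xnf)
    where
    item : ∀ {h} → (∃[ f ] ∃[ g ] Linear f × Linear g × h ≈ f * g) ⊎ Linear h →
           (∃[ f ] ∃[ g ] Linear f × Linear g × ι′ h ≈ f * g) ⊎ Linear (ι′ h)
    item {h} (inj₂ lin) = inj₂ (linear-ι h lin)
    item {h} (inj₁ (f , g , linf , ling , h≈)) =
      inj₁ (ι′ f , ι′ g , linear-ι f linf , linear-ι g ling , ≐⇒≈ (ι′ h) (ι′ f * ι′ g)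
        λ q → trans (ι-≐ h (f * g) (≈⇒≐ h (f * g) h≈) q) (ι-* f g q))

  newY : BoolPoly₂ n (suc i)
  newY = X (n ↑ʳ fromℕ i)

  eval-newY : ∀ b p → eval (p ▹ b) newY ≡ b
  eval-newY b p = trans (eval-X (p ▹ b) _) (lookup-extend n b p)

  eval-ιX : ∀ b p u → eval (p ▹ b) (ι′ (X u)) ≡ lookup p u
  eval-ιX b p u = trans (eval-ι b p (X u)) (eval-X p u)

  -- Definitionally the list that `body` builds, with `u` and `v` the indices of ℓ₁ and ℓ₂.
  adjoin : Fin (n ℕ.+ i) → Fin (n ℕ.+ i) → List (BoolPoly₂ n i) → List (BoolPoly₂ n (suc i))
  adjoin u v M = newY * (ι′ (X v) + 1#) ∷ ι′ (X v) * (ι′ (X u) + newY) ∷ List.map ι′ M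


  eval-gate₁ : ∀ b p v → eval (p ▹ b) (newY * (ι′ (X v) + 1#)) ≡ b ∧ (lookup p v xor true)
  eval-gate₁ b p v = trans (eval-* (p ▹ b) newY (ι′ (X v) + 1#)) (cong₂ _∧_ (eval-newY b p)
    (trans (eval-+ (p ▹ b) (ι′ (X v)) 1#) (cong₂ _xor_ (eval-ιX b p v) (eval-1 (p ▹ b)))))

  eval-gate₂ : ∀ b p u v → eval (p ▹ b) (ι′ (X v) * (ι′ (X u) + newY)) ≡
                           lookup p v ∧ (lookup p u xor b)
  eval-gate₂ b p u v = trans (eval-* (p ▹ b) (ι′ (X v)) (ι′ (X u) + newY))
    (cong₂ _∧_ (eval-ιX b p v)
      (trans (eval-+ (p ▹ b) (ι′ (X u)) newY) (cong₂ _xor_ (eval-ιX b p u) (eval-newY b p))))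

  gates-solved : ∀ x y → (x ∧ y) ∧ (y xor true) ≡ false × y ∧ (x xor (x ∧ y)) ≡ false
  gates-solved false false = refl , refl
  gates-solved false true  = refl , refl
  gates-solved true  false = refl , refl
  gates-solved true  true  = refl , refl

  -- `b` stands for the new indeterminate, `x` for ℓ₁ and `y` for ℓ₂. Where `y` is false the first
  -- gate makes `b` false; where it is true the second makes `b` equal to `x`.
  gates-force : ∀ b x y → b ∧ (y xor true) ≡ false → y ∧ (x xor b) ≡ false → b ≡ x ∧ y
  gates-force false false y     _  _  = refl
  gates-force false true  false _  _  = refl
  gates-force false true  true  _  ()
  gates-force true  x     false () _
  gates-force true  true  true  _  _  = refl
  gates-force true  false true  _  ()

  -- Together with `adjoin-zero⁻`: every zero of `M` extends to exactly one zero of the enlarged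
  -- list.
  adjoin-zero⁺ : ∀ {M} u v {p} → p ∈ 𝒵 (_∈ₗ M) →
                 p ▹ (lookup p u ∧ lookup p v) ∈ 𝒵 (_∈ₗ adjoin u v M)
  adjoin-zero⁺ u v {p} z (here refl) =
    trans (eval-gate₁ _ p v) (proj₁ (gates-solved (lookup p u) (lookup p v)))
  adjoin-zero⁺ u v {p} z (there (here refl)) =
    trans (eval-gate₂ _ p u v) (proj₂ (gates-solved (lookup p u) (lookup p v)))
  adjoin-zero⁺ u v {p} z (there (there h∈)) with ∈-map⁻ ι′ h∈
  ... | f , f∈ , refl = trans (eval-ι _ p f) (z f∈)

  adjoin-zero⁻ : ∀ {M} u v {b p} → p ▹ b ∈ 𝒵 (_∈ₗ adjoin u v M) →
                 p ∈ 𝒵 (_∈ₗ M) × b ≡ lookup p u ∧ lookup p v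
  adjoin-zero⁻ u v {b} {p} z =
    (λ {f} f∈ → trans (sym (eval-ι b p f)) (z (there (there (∈-map⁺ ι′ f∈))))) ,
    gates-force b (lookup p u) (lookup p v)
      (trans (sym (eval-gate₁ b p v)) (z (here refl)))
      (trans (sym (eval-gate₂ b p u v)) (z (there (here refl))))

-- Correctness

module _ {n : ℕ} (f₀ : BoolPoly n) where

  -- ρ is the part of f not known to be linear: the sum of the current term
  -- and of the terms not treated yet.
  record Invariant {i : ℕ} (M : List (BoolPoly₂ n i)) (f : BoolPoly₂ n i)
                   (ρ : Point (n ℕ.+ i) → Bool) : Set where
    field
      is2XNF     : Is2XNF M
      linearPart : ∃[ g ] Linear g × (∀ p → eval p f ≡ eval p g xor ρ p)
      agrees     : ∀ {p} → p ∈ 𝒵 (_∈ₗ M) → eval p f ≡ eval (take n p) f₀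
      unique     : ∀ {p q} → p ∈ 𝒵 (_∈ₗ M) → q ∈ 𝒵 (_∈ₗ M) → take n p ≡ take n q → p ≡ q
      lift       : ∀ x → ∃[ p ] p ∈ 𝒵 (_∈ₗ M) × take n p ≡ x

  open Invariant

  remaining : List (Term n) → Point (n ℕ.+ i) → Bool
  remaining todo p = xorSum (evalTerm (take n p)) todo

  -- One assertion per control point, in the style of Floyd and Hoare; at `return` it is the claim
  -- itself.
  Correct : State n → Set
  Correct (input f)            = f ≡ f₀
  Correct (for todo i M f)     = Invariant M f (remaining todo)
  Correct (while todo i M t f) = Invariant M f (λ p → evalTerm p t xor remaining todo p)
  Correct (return m S)         = Is2XNFRepresentation ⟨ f₀ ⟩ m S

  start-correct : ∀ {L} → IsSupport f₀ L → Invariant {0} [] (ι₀ f₀) (remaining L)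
  start-correct isSupp = record
    { is2XNF     = []
    -- Even the support terms of degree at most 1 still count in `ρ`; they join the linear part only
    -- when their turn comes.
    ; linearPart = 0# , linear-0 , λ p →
        trans (eval-ι₀ p f₀) (eval-support f₀ isSupp (take n p))
    ; agrees     = λ {p} _ → eval-ι₀ p f₀
    ; unique     = λ {p} {q} _ _ → take-injective n p q
    ; lift       = λ x → x ++ [] , (λ ()) , take-++-[] n x
    }

  enter-correct : ∀ t todo {M} {f : BoolPoly₂ n i} → Invariant M f (remaining (t ∷ todo)) →
    Invariant M f (λ p → evalTerm p (t ++ Subset.⊥) xor remaining todo p)
  enter-correct t todo inv = record
    { is2XNF     = is2XNF inv
    ; linearPart = let g , lin , f≡ = linearPart inv in g , lin , λ p →
        trans (f≡ p) (cong (λ b → eval p g xor (b xor remaining todo p)) (sym (evalTerm-++-⊥ n p t)))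
    ; agrees     = agrees inv
    ; unique     = unique inv
    ; lift       = lift inv
    }

  -- The polynomial stays as it is; only the bookkeeping changes, with `t` moving from `ρ` to the
  -- linear part.
  exit-correct : ∀ t todo {M} {f : BoolPoly₂ n i} → deg t ℕ.≤ 1 →
    Invariant M f (λ p → evalTerm p t xor remaining todo p) → Invariant M f (remaining todo)
  exit-correct t todo t≤1 inv = record
    { is2XNF     = is2XNF inv
    ; linearPart = let g , lin , f≡ = linearPart inv in
        g + term t , linear-+ g (term t) lin (linear-term t t≤1) , λ p →
          trans (f≡ p) (trans (sym (xor-assoc (eval p g) _ _)) (cong (_xor remaining todo p)
            (sym (trans (eval-+ p g (term t)) (cong (eval p g xor_) (eval-term p t))))))
    ; agrees     = agrees inv
    ; unique     = unique inv
    ; lift       = lift inv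
    }

  module _ {i} {M : List (BoolPoly₂ n i)} {t} todo {f u v}
           (u≢v : u ≢ v) (u∈t : u Subset.∈ t) (v∈t : v Subset.∈ t)
           (inv : Invariant M f (λ p → evalTerm p t xor remaining todo p)) where

    open Adjunction n i

    s : Term (n ℕ.+ i)
    s = t Subset.- u Subset.- v

    ys : Term (n ℕ.+ suc i)
    ys = extend {n = n} inside s

    f⁺ : BoolPoly₂ n (suc i)
    f⁺ = term ys + ι′ (f + - term t)

    evalTerm-split : ∀ p → evalTerm p t ≡ (lookup p u ∧ lookup p v) ∧ evalTerm p s
    evalTerm-split p = trans (evalTerm-remove p u∈t) (trans
      (cong (lookup p u ∧_) (evalTerm-remove p (x∈p∧x≢y⇒x∈p-y v∈t (u≢v ∘ sym))))
      (sym (∧-assoc (lookup p u) _ _)))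

    eval-f⁺ : ∀ b p → eval (p ▹ b) f⁺ ≡ (b ∧ evalTerm p s) xor (eval p f xor evalTerm p t)
    eval-f⁺ b p = trans (eval-+ (p ▹ b) (term ys) (ι′ (f + - term t)))
      (cong₂ _xor_ (trans (eval-term (p ▹ b) ys) (evalTerm-extend n b p s))
        (trans (eval-ι b p (f + - term t))
          (trans (eval-+ p f (term t)) (cong (eval p f xor_) (eval-term p t)))))

    body-correct : Invariant (adjoin u v M) f⁺ (λ p → evalTerm p ys xor remaining todo p)
    body-correct = record
      { is2XNF     =
          inj₁ (newY , ι′ (X v) + 1# , linear-X _
               , linear-+ (ι′ (X v)) 1# (linear-ιX v) linear-1
               , ≈-refl (newY * (ι′ (X v) + 1#)))
        ∷ inj₁ (ι′ (X v) , ι′ (X u) + newY , linear-ιX v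
               , linear-+ (ι′ (X u)) newY (linear-ιX u) (linear-X _)
               , ≈-refl (ι′ (X v) * (ι′ (X u) + newY)))
        ∷ is2XNF-ι (is2XNF inv)
      ; linearPart = ι′ g , linear-ι g lin , linearPart⁺
      ; agrees     = agrees⁺
      ; unique     = unique⁺
      ; lift       = lift⁺
      }
      where
      open ≡-Reasoning
      open xor-∧-Solver
      g   = proj₁ (linearPart inv)
      lin = proj₁ (proj₂ (linearPart inv))
      f≡  = proj₂ (proj₂ (linearPart inv))

      linearPart⁺ : ∀ q → eval q f⁺ ≡ eval q (ι′ g) xor (evalTerm q ys xor remaining todo q)
      linearPart⁺ q with extend-surjective n q
      ... | b , p , refl = begin
        eval (p ▹ b) f⁺
          ≡⟨ eval-f⁺ b p ⟩
        (b ∧ evalTerm p s) xor (eval p f xor evalTerm p t)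
          ≡⟨ cong (λ x → (b ∧ evalTerm p s) xor (x xor evalTerm p t)) (f≡ p) ⟩
        (b ∧ evalTerm p s) xor ((eval p g xor (evalTerm p t xor remaining todo p)) xor evalTerm p t)
          -- The `t` subtracted from `f` cancels the `t` recorded in `ρ`; it need not occur
          -- literally in the list `f`.
          ≡⟨ solve 4 (λ a g t r → a :+ ((g :+ (t :+ r)) :+ t) := g :+ (a :+ r)) refl
               (b ∧ evalTerm p s) (eval p g) (evalTerm p t) (remaining todo p) ⟩
        eval p g xor ((b ∧ evalTerm p s) xor remaining todo p)
          ≡⟨ cong₂ _xor_ (eval-ι b p g) (cong₂ _xor_ (evalTerm-extend n b p s)
               (cong (λ x → xorSum (evalTerm x) todo) (take-extend n b p))) ⟨
        eval (p ▹ b) (ι′ g) xor (evalTerm (p ▹ b) ys xor remaining todo (p ▹ b)) ∎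

      agrees⁺ : ∀ {q} → q ∈ 𝒵 (_∈ₗ adjoin u v M) → eval q f⁺ ≡ eval (take n q) f₀
      agrees⁺ {q} z with extend-surjective n q
      ... | b , p , refl = begin
        eval (p ▹ b) f⁺
          ≡⟨ eval-f⁺ b p ⟩
        (b ∧ evalTerm p s) xor (eval p f xor evalTerm p t)
          ≡⟨ cong (λ x → (x ∧ evalTerm p s) xor (eval p f xor evalTerm p t)) b≡ ⟩
        ((lookup p u ∧ lookup p v) ∧ evalTerm p s) xor (eval p f xor evalTerm p t)
          ≡⟨ cong (_xor (eval p f xor evalTerm p t)) (evalTerm-split p) ⟨
        evalTerm p t xor (eval p f xor evalTerm p t)
          ≡⟨ solve 2 (λ t f → t :+ (f :+ t) := f) refl (evalTerm p t) (eval p f) ⟩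
        eval p f
          ≡⟨ agrees inv z′ ⟩
        eval (take n p) f₀
          ≡⟨ cong (λ x → eval x f₀) (take-extend n b p) ⟨
        eval (take n (p ▹ b)) f₀ ∎
        where
        z′ : p ∈ 𝒵 (_∈ₗ M)
        z′ = proj₁ (adjoin-zero⁻ u v z)
        b≡ = proj₂ (adjoin-zero⁻ {M = M} u v z)

      unique⁺ : ∀ {q r} → q ∈ 𝒵 (_∈ₗ adjoin u v M) → r ∈ 𝒵 (_∈ₗ adjoin u v M) →
                take n q ≡ take n r → q ≡ r
      unique⁺ {q} {r} zq zr q≡r with extend-surjective n q | extend-surjective n r
      ... | b , p , refl | b′ , p′ , refl with adjoin-zero⁻ {M = M} u v zq | adjoin-zero⁻ {M = M} u v zr
      -- Both new coordinates have been forced to the same function of the old ones, so it is enough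
      -- that the old points agree.
      ... | zp , refl | zp′ , refl = cong (λ p → p ▹ (lookup p u ∧ lookup p v))
        (unique inv zp zp′ (trans (sym (take-extend n _ p)) (trans q≡r (take-extend n _ p′))))

      lift⁺ : ∀ x → ∃[ q ] q ∈ 𝒵 (_∈ₗ adjoin u v M) × take n q ≡ x
      lift⁺ x with lift inv x
      ... | p , zp , p≡x = _ , adjoin-zero⁺ u v zp , trans (take-extend n _ p) p≡x

  -- With nothing left to treat, `ρ` vanishes and `f` is linear. On the zeros of `M` the values of
  -- `f` are those of `f₀`, so adjoining `f` keeps exactly the points lying over zeros of `f₀`.
  done-correct : ∀ {M} {f : BoolPoly₂ n i} → Invariant M f (remaining []) →
                 Is2XNFRepresentation ⟨ f₀ ⟩ i (f ∷ M)
  done-correct {i} {M} {f} inv = inj₂ linear-f ∷ is2XNF inv , into ,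
    (λ {x} {y} → injective {x} {y}) , surjective
    where
    linear-f : Linear f
    linear-f = let g , lin , f≡ = linearPart inv in
      linear-≐ f g (λ p → trans (f≡ p) (xor-identityʳ (eval p g))) lin
    into : ∀ p → p ∈ 𝒵 (_∈ₗ f ∷ M) → take n p ∈ 𝒵 ⟨ f₀ ⟩
    into p z h∈ = eval-Ideal h∈ (take n p) (trans (sym (agrees inv (z ∘ there))) (z (here refl)))
    injective : ∀ {x y : ∃ (𝒵 (_∈ₗ f ∷ M))} → take n (proj₁ x) ≡ take n (proj₁ y) →
                proj₁ x ≡ proj₁ y
    injective {_ , z} {_ , z′} = unique inv (z ∘ there) (z′ ∘ there)
    surjective : ∀ (y : ∃ (𝒵 ⟨ f₀ ⟩)) → ∃[ x ] ∀ {z : ∃ (𝒵 (_∈ₗ f ∷ M))} →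
                 proj₁ z ≡ proj₁ x → take n (proj₁ z) ≡ proj₁ y
    surjective (y , zy) with lift inv y
    ... | p , zp , p≡y = (p , λ {h} → zero-p {h}) , λ { refl → p≡y }
      where
      zero-p : ∀ {h} → h ∈ₗ f ∷ M → eval p h ≡ false
      zero-p (here refl) = trans (agrees inv zp)
        (trans (cong (λ x → eval x f₀) p≡y) (zy (gen refl)))
      zero-p (there h∈)  = zp h∈

  step-correct : ∀ {σ τ} → σ ⟶ τ → Correct σ → Correct τ
  step-correct (start isSupp)            refl = start-correct isSupp
  step-correct (enter {t} {todo})        inv  = enter-correct t todo inv
  step-correct (body {todo} _ u≢v u∈t v∈t) inv = body-correct todo u≢v u∈t v∈t inv
  step-correct (exit {todo} {t = t} t≤1) inv  = exit-correct t todo t≤1 inv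
  step-correct done                      inv  = done-correct inv

  run-correct : ∀ {σ τ} → σ ⟶* τ → Correct σ → Correct τ
  run-correct ε             = id
  run-correct (step ◅ steps) = run-correct steps ∘ step-correct step

  progress : ∀ (σ : State n) → (∃[ τ ] σ ⟶ τ) ⊎ (∃[ m ] ∃[ S ] σ ≡ return m S)
  -- The rule `start` needs some enumeration of the support; the computed one shows that there is
  -- one.
  progress (input f)              = inj₁ (_ , start (support-isSupport f))
  progress (for [] i M f)         = inj₁ (_ , done)
  progress (for (t ∷ todo) i M f) = inj₁ (_ , enter)
  progress (while todo i M t f) with deg t ℕ.≤? 1
  ... | yes t≤1 = inj₁ (_ , exit t≤1)
  ... | no  t≰1 with deg>1⇒two t (ℕ.≰⇒> t≰1)
  ...   | u , v , u≢v , u∈t , v∈t = inj₁ (_ , body (ℕ.≰⇒> t≰1) u≢v u∈t v∈t)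
  progress (return m S)           = inj₂ (m , S , refl)

  returns : Returns (input f₀) (Is2XNFRepresentation ⟨ f₀ ⟩)
  returns {τ} run with progress τ
  ... | inj₁ step           = inj₁ step
  ... | inj₂ (m , S , refl) = inj₂ (m , S , refl , run-correct run refl)

-- Termination

-- Two indeterminates leave the term and only one enters.
body-decreases-deg : ∀ {t : Term (n ℕ.+ i)} {u v} → u ≢ v → u Subset.∈ t → v Subset.∈ t →
  deg (extend {n = n} {i} inside (t Subset.- u Subset.- v)) ℕ.< deg t
body-decreases-deg {n} {t = t} {u} {v} u≢v u∈t v∈t =
  subst (ℕ._< deg t) (sym (∣extend∣ n inside _))
    (ℕ.≤-<-trans (x∈p⇒∣p-x∣<∣p∣ (x∈p∧x≢y⇒x∈p-y v∈t (u≢v ∘ sym))) (x∈p⇒∣p-x∣<∣p∣ u∈t))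

-- Termination of the outer loop is assumed for every `i`, `M` and `f`, because the body changes all
-- three.
while-terminates : ∀ {todo : List (Term n)} → (∀ {i} M f → Terminates (for todo i M f)) →
  ∀ {i} M t f → Acc ℕ._<_ (deg t) → Terminates (while todo i M t f)
while-terminates {n} for-acc M t f (acc rs) = acc λ where
  (exit _)                → for-acc M f
  (body _ u≢v u∈t v∈t) → while-terminates for-acc _ _ _ (rs (body-decreases-deg {n} u≢v u∈t v∈t))

for-terminates : ∀ (todo : List (Term n)) {i} M f → Terminates (for todo i M f)
for-terminates []         M f = acc λ { done → acc λ () }
for-terminates (t ∷ todo) M f = acc λ where
  enter → while-terminates (for-terminates todo) M _ f (<-wellFounded _)

proposition3p15 : (n : ℕ) (f : BoolPoly n) →
    Terminates (input f) × Returns (input f) (Is2XNFRepresentation ⟨ f ⟩)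
proposition3p15 n f = acc (λ { (start _) → for-terminates _ _ _ }) , returns f
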